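{- For every $n>0$, the core label order $\mathrm{CLO}(\mathrm{Hoch}(n))$ of the Hochschild lattice $\mathrm{Hoch}(n)$ is isomorphic, as a poset, to the shuffle lattice $\mathrm{Shuf}(n-1,1)$.
   Context: Hochschild lattice. For $n\geq 1$, a triword of length $n$ is a tuple $u=(u_1,\ldots,u_n)$ such that (T1) $u_i\in\{0,1,2\}$ for all $i$; (T2) $u_1\neq 2$; (T3) if $u_i=0$, then $u_j\neq 1$ for all $j>i$. Let $\mathrm{Tri}(n)$ be the set of all triwords of length $n$. The Hochschild lattice is $\mathrm{Hoch}(n)=(\mathrm{Tri}(n),\leq)$ where $\leq$ is the componentwise order. It is known to be a semidistributive lattice: the join is the componentwise maximum, and the meet is obtained by taking the componentwise minimum and then replacing by $0$ every entry $1$ that has an entry $0$ somewhere to its left. Core label order. Let $L$ be a finite semidistributive lattice. For a cover relation $a\lessdot b$ put $\lambda(a,b)=\min\{c\in L\mid a\vee c=b\}$; this minimum exists and is join irreducible. The nucleus of $a\in L$ is $a_\downarrow=a\wedge\bigwedge_{b\lessdot a}b$. The core label set of $a$ is $\Psi(a)=\{\lambda(b,b')\mid a_\downarrow\leq b\lessdot b'\leq a\}$. The map $a\mapsto\Psi(a)$ is injective. The core label order $\mathrm{CLO}(L)$ is the poset $(L,\sqsubseteq)$ where $a\sqsubseteq b$ if and only if $\Psi(a)\subseteq\Psi(b)$. Shuffle lattice. Let $A=\{a_1,\ldots,a_k\}$ and $B=\{b_1,\ldots,b_l\}$ be disjoint sets of $k$ and $l$ letters. The elements of $\mathrm{Shuf}(k,l)$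 are all words $w$ over $A\uplus B$ such that the restriction of $w$ to letters in $A$ is a (not necessarily contiguous, possibly empty) subword of $a_1a_2\cdots a_k$ and the restriction of $w$ to letters in $B$ is a subword of $b_1b_2\cdots b_l$. The order is: $w_1\preceq w_2$ if and only if $w_2$ can be obtained from $w_1$ by removing letters of $A$ and/or adding letters of $B$. -}

module Defs where

open import Level using (_⊔_)
open import Data.Fin.Base using (Fin; zero; suc; toℕ; _≤_; _<_)
open import Data.Fin.Patterns using (0F; 1F; 2F)
open import Data.Fin.Properties as Fin using (_≟_; _<?_; any?; ≤-totalOrder)
open import Data.List.Base using (List; _∷_; allFin; mapMaybe)
open import Data.List.Relation.Binary.Sublist.Propositional using (_⊆_)
open import Data.Nat.Base using (ℕ; z≤n; s≤s)
open import Data.Product.Base using (_×_; _,_; ∃; ∃-syntax)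
open import Data.Sum.Base using (_⊎_; inj₁; inj₂)
open import Data.Sum using (isInj₁; isInj₂)
open import Data.Vec.Functional using (Vector; zipWith)
open import Data.Vec.Functional.Relation.Binary.Pointwise using (Pointwise)
open import Function.Base using (_on_)
open import Relation.Binary.Core using (Rel)
open import Relation.Binary.Construct.Closure.ReflexiveTransitive using (Star)
import Relation.Binary.Construct.NonStrictToStrict as Strict
open import Relation.Binary.Lattice using (Lattice)
open import Relation.Binary.PropositionalEquality
  using (_≡_; _≢_; refl; sym; trans; subst)
open import Relation.Nullary using (¬_; Dec; yes; no; contradiction)
open import Relation.Nullary.Decidable using (_×-dec_)
open import Relation.Unary using (Pred) renaming (_⊆_ to _⊆ₚ_)
import Algebra.Construct.NaturalChoice.Max as Max
import Algebra.Construct.NaturalChoice.Min as Min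

module CoreLabelOrder {c ℓ₁ ℓ₂} (L : Lattice c ℓ₁ ℓ₂) where
  open Lattice L using (Carrier; _≈_; _∨_) renaming (_≤_ to _≤ᴸ_)
  open Strict _≈_ _≤ᴸ_ using () renaming (_<_ to _<ᴸ_)

  infix 4 _⋖_ _⊑_

  _⋖_ : Rel Carrier (c ⊔ ℓ₁ ⊔ ℓ₂)
  a ⋖ b = a <ᴸ b × ¬ (∃[ x ] (a <ᴸ x × x <ᴸ b))

  IsMinimumOf : ∀ {ℓ} → Pred Carrier ℓ → Pred Carrier (c ⊔ ℓ₂ ⊔ ℓ)
  IsMinimumOf S m = S m × (∀ x → S x → m ≤ᴸ x)

  IsMeetOf : ∀ {ℓ} → Pred Carrier ℓ → Pred Carrier (c ⊔ ℓ₂ ⊔ ℓ)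
  IsMeetOf S m = (∀ x → S x → m ≤ᴸ x)
               × (∀ y → (∀ x → S x → y ≤ᴸ x) → y ≤ᴸ m)

  -- Minima and meets are given as relations rather than operations, since
  -- for an arbitrary lattice they need not exist; they are unique up to _≈_.
  -- In a finite semidistributive lattice they always exist.

  -- l = λ(a, b)
  IsLabel : Carrier → Carrier → Pred Carrier (c ⊔ ℓ₁ ⊔ ℓ₂)
  IsLabel a b l = IsMinimumOf (λ x → (a ∨ x) ≈ b) l

  -- d = a↓; including a itself in the meet makes a↓ = a when a is the bottom.
  IsNucleus : Carrier → Pred Carrier (c ⊔ ℓ₁ ⊔ ℓ₂)
  IsNucleus a d = IsMeetOf (λ x → x ≈ a ⊎ x ⋖ a) d

  Ψ : Carrier → Pred Carrier (c ⊔ ℓ₁ ⊔ ℓ₂)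
  Ψ a l = ∃[ d ] ∃[ b ] ∃[ b′ ]
    (IsNucleus a d × d ≤ᴸ b × b ⋖ b′ × b′ ≤ᴸ a × IsLabel b b′ l)

  _⊑_ : Rel Carrier (c ⊔ ℓ₁ ⊔ ℓ₂)
  a ⊑ b = Ψ a ⊆ₚ Ψ b

-- Condition (T1), entries in {0,1,2}, is the type Fin 3.  Stating T2 through
-- toℕ i ≡ 0 lets Tri be defined for every n, including n = 0.
record Tri (n : ℕ) : Set where
  field
    entry : Vector (Fin 3) n
    T2    : ∀ i → toℕ i ≡ 0 → entry i ≢ 2F
    T3    : ∀ i j → i < j → entry i ≡ 0F → entry j ≢ 1F

open Tri public

infix 4 _≈ᵀ_ _≤ᵀ_

_≈ᵀ_ : ∀ {n} → Rel (Tri n) _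
_≈ᵀ_ = Pointwise _≡_ on entry

_≤ᵀ_ : ∀ {n} → Rel (Tri n) _
_≤ᵀ_ = Pointwise _≤_ on entry

module Mx = Max (≤-totalOrder 3)
module Mn = Min (≤-totalOrder 3)
open Mx public using () renaming (_⊔_ to _⊔₃_)
open Mn public using () renaming (_⊓_ to _⊓₃_)

bad? : ∀ {n} (w : Vector (Fin 3) n) i →
       Dec (w i ≡ 1F × ∃ λ j → j < i × w j ≡ 0F)
bad? w i = (w i ≟ 1F) ×-dec any? (λ j → (j <? i) ×-dec (w j ≟ 0F))

repair : ∀ {n} → Vector (Fin 3) n → Vector (Fin 3) n
repair w i with bad? w i
... | yes _ = 0F
... | no _  = w i

private
  repair-≤ : ∀ {n} (w : Vector (Fin 3) n) i → repair w i ≤ w i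
  repair-≤ w i with bad? w i
  ... | yes _ = z≤n
  ... | no _  = Fin.≤-refl

  repair-T3 : ∀ {n} (w : Vector (Fin 3) n) i j → i < j →
              repair w i ≡ 0F → repair w j ≢ 1F
  repair-T3 w i j i<j p q with bad? w i | bad? w j
  repair-T3 w i j i<j p () | _ | yes _
  ... | no _ | no ¬b = ¬b (q , i , i<j , p)
  ... | yes (_ , k , k<i , r) | no ¬b = ¬b (q , k , Fin.<-trans k<i i<j , r)

  ≤0⇒≡0 : {x : Fin 3} → x ≤ zero {2} → x ≡ 0F
  ≤0⇒≡0 {0F} _ = refl

  ≤1∧≢1⇒≤0 : {x : Fin 3} → x ≤ suc (zero {1}) → x ≢ 1F → x ≤ zero {2}
  ≤1∧≢1⇒≤0 {0F} _ _ = z≤n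
  ≤1∧≢1⇒≤0 {1F} _ x≢1 = contradiction refl x≢1
  ≤1∧≢1⇒≤0 {2F} (s≤s ()) _

  ≤-repair : ∀ {n} (t : Tri n) (w : Vector (Fin 3) n) →
             (∀ i → entry t i ≤ w i) → ∀ i → entry t i ≤ repair w i
  ≤-repair t w t≤w i with bad? w i
  ... | no _ = t≤w i
  ... | yes (wi≡1 , j , j<i , wj≡0) =
    ≤1∧≢1⇒≤0 (subst (entry t i ≤_) wi≡1 (t≤w i))
             (T3 t j i j<i (≤0⇒≡0 (subst (entry t j ≤_) wj≡0 (t≤w j))))

  ≢2-⊔ : ∀ x y → x ≢ 2F → y ≢ 2F → x ⊔₃ y ≢ 2F
  ≢2-⊔ x y p q r with Mx.⊔-sel x y
  ... | inj₁ e = p (trans (sym e) r)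
  ... | inj₂ e = q (trans (sym e) r)

  ⊔-T3 : ∀ x y x′ y′ → (x ≡ 0F → x′ ≢ 1F) → (y ≡ 0F → y′ ≢ 1F) →
         x ⊔₃ y ≡ 0F → x′ ⊔₃ y′ ≢ 1F
  ⊔-T3 x y x′ y′ p q r s with Mx.⊔-sel x′ y′
  ... | inj₁ e = p (≤0⇒≡0 (subst (x ≤_) r (Mx.x≤x⊔y x y))) (trans (sym e) s)
  ... | inj₂ e = q (≤0⇒≡0 (subst (y ≤_) r (Mx.x≤y⊔x x y))) (trans (sym e) s)

infixr 6 _∨ᵀ_
infixr 7 _∧ᵀ_

_∨ᵀ_ : ∀ {n} → Tri n → Tri n → Tri n
u ∨ᵀ v = record
  { entry = zipWith _⊔₃_ (entry u) (entry v)
  ; T2    = λ i p → ≢2-⊔ _ _ (T2 u i p) (T2 v i p)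
  ; T3    = λ i j i<j → ⊔-T3 _ _ _ _ (T3 u i j i<j) (T3 v i j i<j)
  }

_∧ᵀ_ : ∀ {n} → Tri n → Tri n → Tri n
_∧ᵀ_ {n} u v = record
  { entry = repair w
  ; T2    = λ i p q → T2 u i p (≥2⇒≡2 (subst (_≤ entry u i) q
              (Fin.≤-trans (repair-≤ w i) (Mn.x⊓y≤x (entry u i) (entry v i)))))
  ; T3    = repair-T3 w
  }
  where
  w : Vector (Fin 3) n
  w = zipWith _⊓₃_ (entry u) (entry v)

  ≥2⇒≡2 : {x : Fin 3} → suc (suc (zero {0})) ≤ x → x ≡ 2F
  ≥2⇒≡2 {1F} (s≤s ())
  ≥2⇒≡2 {2F} _ = refl

Hoch : ℕ → Lattice _ _ _
Hoch n = record
  { Carrier   = Tri n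
  ; _≈_       = _≈ᵀ_
  ; _≤_       = _≤ᵀ_
  ; _∨_       = _∨ᵀ_
  ; _∧_       = _∧ᵀ_
  ; isLattice = record
    { isPartialOrder = record
      { isPreorder = record
        { isEquivalence = record
          { refl  = λ _ → refl
          ; sym   = λ p i → sym (p i)
          ; trans = λ p q i → trans (p i) (q i)
          }
        ; reflexive = λ p i → Fin.≤-reflexive (p i)
        ; trans     = λ p q i → Fin.≤-trans (p i) (q i)
        }
      ; antisym = λ p q i → Fin.≤-antisym (p i) (q i)
      }
    ; supremum = λ u v →
        (λ i → Mx.x≤x⊔y (entry u i) (entry v i))
      , (λ i → Mx.x≤y⊔x (entry u i) (entry v i))
      , (λ z p q i → Mx.⊔-lub (p i) (q i))
    ; infimum = λ u v →
        (λ i → Fin.≤-trans (repair-≤ (zipWith _⊓₃_ (entry u) (entry v)) i)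
            (Mn.x⊓y≤x (entry u i) (entry v i)))
      , (λ i → Fin.≤-trans (repair-≤ (zipWith _⊓₃_ (entry u) (entry v)) i)
            (Mn.x⊓y≤y (entry u i) (entry v i)))
      , (λ z p q → ≤-repair z _ (λ i → Mn.⊓-glb (p i) (q i)))
    }
  }

-- inj₁ i and inj₂ j stand for the i-th letter of A and the j-th letter of B
-- (counted from zero), so allFin k is the word a₁a₂⋯a_k.
Word : ℕ → ℕ → Set
Word k l = List (Fin k ⊎ Fin l)

record Shuf (k l : ℕ) : Set where
  field
    word      : Word k l
    A-subword : mapMaybe isInj₁ word ⊆ allFin k
    B-subword : mapMaybe isInj₂ word ⊆ allFin l

open Shuf public

infix 4 _⟶_ _≈ˢ_ _≼_

data _⟶_ {k l : ℕ} : Rel (Word k l) Level.zero where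
  remove : ∀ {a w} → (inj₁ a ∷ w) ⟶ w
  add    : ∀ {b w} → w ⟶ (inj₂ b ∷ w)
  there  : ∀ {x w w′} → w ⟶ w′ → (x ∷ w) ⟶ (x ∷ w′)

-- The proofs that a word is in Shuf k l play no role in equality.
_≈ˢ_ : ∀ {k l} → Rel (Shuf k l) _
_≈ˢ_ = _≡_ on word

-- Intermediate words are unrestricted, which does not change the relation:
-- removing all letters first and then adding stays within Shuf k l.
_≼_ : ∀ {k l} → Rel (Shuf k l) _
_≼_ = Star _⟶_ on word

{-# OPTIONS --safe #-}
module Submission where

-- The label of a cover relation is a least triword with a prescribed nonzero
-- entry: either 2 at i, all else 0, or 1 up to t, then 0.  Labels of the first
-- kind lie in Ψ(u) iff uᵢ = 2, labels of the second kind iff u has no 0 up to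
-- t and no 1 beyond t.  Hence Ψ(u) ⊆ Ψ(v) iff every 2 of u is a 2 of v and, in
-- case u₁ = 1, every other entry of v agrees with that of u.
--
-- The isomorphism sends u to the word of the letters aᵢ with uᵢ₊₁ ≠ 2 and, if
-- u₁ = 1, a letter b separating the letters with entry 1 from those with
-- entry 0.  The order on words is recovered from what a step cannot create:
-- a letter aᵢ in front of all b's, a letter aᵢ behind all b's, the absence of b.

open import Defs
open import Data.Fin.Base using (Fin; zero; suc; toℕ; _≤_; _<_)
open import Data.Fin.Patterns using (0F; 1F; 2F)
open import Data.Fin.Properties as Fin using (_≟_; _<?_; _≤?_; any?; all?)
open import Data.List.Base using ([]; _∷_; mapMaybe; tabulate)
open import Data.List.Membership.Propositional using (_∈_)
open import Data.List.Properties using (∷-injectiveʳ)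
open import Data.List.Relation.Binary.Sublist.Propositional
  using (_⊆_; []; _∷_; _∷ʳ_; minimum)
open import Data.List.Relation.Unary.Any using (here; there)
open import Data.Nat.Base as ℕ using (ℕ; zero; suc; _>_; _∸_; z≤n; s≤s)
import Data.Nat.Properties as ℕ
open import Data.Product.Base using (_×_; _,_; ∃; proj₁; proj₂)
open import Data.Sum using (isInj₁; isInj₂)
open import Data.Sum.Base using (_⊎_; inj₁; inj₂)
open import Data.Vec.Functional as Vector using (Vector; updateAt)
open import Data.Vec.Functional.Properties using (updateAt-updates; updateAt-minimal)
open import Function.Base using (_∘_; const; id)
open import Level using (0ℓ)
open import Relation.Binary.Construct.Closure.ReflexiveTransitive
  using (Star; ε; _◅_; fold; gmap)
open import Relation.Binary.Lattice using (Lattice)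
open import Relation.Binary.Morphism.Structures using (IsOrderIsomorphism)
open import Relation.Binary.PropositionalEquality
  using (_≡_; _≢_; refl; sym; trans; cong; subst; subst₂)
open import Relation.Nullary using (¬_; Dec; yes; no; contradiction)
open import Relation.Nullary.Decidable using (_×-dec_; decidable-stable)
open import Relation.Unary using (Pred; Decidable)

-- Entries of triwords, and entries given by decidable predicates.

≤0⇒≡0 : {x : Fin 3} → x ≤ zero {2} → x ≡ 0F
≤0⇒≡0 {0F} _ = refl

≥2⇒≡2 : {x : Fin 3} → suc (suc (zero {0})) ≤ x → x ≡ 2F
≥2⇒≡2 {1F} (s≤s ())
≥2⇒≡2 {2F} _ = refl

≢0-mono : {x y : Fin 3} → x ≤ y → x ≢ 0F → y ≢ 0F
≢0-mono x≤y x≢0 refl = x≢0 (≤0⇒≡0 x≤y)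

≢0∧≢1⇒≡2 : {x : Fin 3} → x ≢ 0F → x ≢ 1F → x ≡ 2F
≢0∧≢1⇒≡2 {0F} p _ = contradiction refl p
≢0∧≢1⇒≡2 {1F} _ q = contradiction refl q
≢0∧≢1⇒≡2 {2F} _ _ = refl

≤1⇒≡0⊎≡1 : {x : Fin 3} → x ≤ suc (zero {1}) → x ≡ 0F ⊎ x ≡ 1F
≤1⇒≡0⊎≡1 {0F} _ = inj₁ refl
≤1⇒≡0⊎≡1 {1F} _ = inj₂ refl
≤1⇒≡0⊎≡1 {2F} (s≤s ())

last : ∀ {n p} {P : Pred (Fin n) p} → Decidable P → ∃ P →
       ∃ λ l → P l × (∀ j → l < j → ¬ P j)
last {suc n} P? (i , pi) with any? (P? ∘ suc)
... | yes ps = let l , pl , max = last (P? ∘ suc) ps in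
  suc l , pl , λ { (suc j) (s≤s l<j) → max j l<j }
last P? (zero , p)  | no ¬ps = zero , p , λ { (suc j) _ pj → ¬ps (j , pj) }
last P? (suc i , p) | no ¬ps = contradiction (i , p) ¬ps

flag : ∀ {p} {P : Set p} → Dec P → Fin 3
flag (yes _) = 1F
flag (no _)  = 0F

module _ {p} {P : Set p} where

  flag-yes : (P? : Dec P) → P → flag P? ≡ 1F
  flag-yes (yes _) _ = refl
  flag-yes (no ¬p) p = contradiction p ¬p

  flag-no : (P? : Dec P) → ¬ P → flag P? ≡ 0F
  flag-no (yes p) ¬p = contradiction p ¬p
  flag-no (no _)  _  = refl

  flag≡0 : (P? : Dec P) → flag P? ≡ 0F → ¬ P
  flag≡0 (no ¬p) _ = ¬p

  flag≡1 : (P? : Dec P) → flag P? ≡ 1F → P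
  flag≡1 (yes p) _ = p

  flag≢2 : (P? : Dec P) → flag P? ≢ 2F
  flag≢2 (yes _) ()
  flag≢2 (no _) ()

  flag-≤ : (P? : Dec P) {x : Fin 3} → (P → x ≢ 0F) → flag P? ≤ x
  flag-≤ (no _)      _ = z≤n
  flag-≤ (yes p) {0F}    x≢0 = contradiction refl (x≢0 p)
  flag-≤ (yes _) {suc _} _ = s≤s z≤n

-- Covers, labels and nuclei in the Hochschild lattice.

module _ {n : ℕ} where
  open CoreLabelOrder (Hoch n)

  onesOn : ∀ {p} {P : Pred (Fin n) p} → Decidable P →
           (∀ {i j} → i < j → P j → P i) → Tri n
  onesOn P? closed = record
    { entry = λ i → flag (P? i)
    ; T2    = λ i _ → flag≢2 (P? i)
    ; T3    = λ i j i<j p q → flag≡0 (P? i) p (closed i<j (flag≡1 (P? j) q))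
    }

  bottom : Tri n
  bottom = record { entry = λ _ → 0F ; T2 = λ _ _ () ; T3 = λ _ _ _ _ () }

  ones : Fin n → Tri n
  ones t = onesOn (_≤? t) (λ i<j j≤t → ℕ.≤-trans (ℕ.<⇒≤ i<j) j≤t)

  OneBeyond : Tri n → Pred (Fin n) 0ℓ
  OneBeyond u i = ∃ λ l → i < l × entry u l ≡ 1F

  oneBeyond? : ∀ u → Decidable (OneBeyond u)
  oneBeyond? u i = any? (λ l → (i <? l) ×-dec (entry u l ≟ 1F))

  -- The result is 1 strictly in front of the last 1 of `u` and 0 from there on. Every 2 of `u` and
  -- its last 1 can be lowered separately, and once the last 1 drops to 0, T3 rules out any 1 behind
  -- it.
  nucleus : Tri n → Tri n
  nucleus u = onesOn (oneBeyond? u)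
    (λ i<j → λ { (l , j<l , p) → l , Fin.<-trans i<j j<l , p })

  module _ (u : Tri n) (j : Fin n) (c : Fin 3)
           (t2 : toℕ j ≡ 0 → c ≢ 2F)
           (zeroOK : c ≡ 0F → ∀ k → j < k → entry u k ≢ 1F)
           (oneOK : c ≡ 1F → ∀ k → k < j → entry u k ≢ 0F) where

    private
      w : Vector (Fin 3) n
      w = updateAt (entry u) j (const c)

      w-j : w j ≡ c
      w-j = updateAt-updates j (entry u)

      w-k : ∀ {k} → k ≢ j → w k ≡ entry u k
      w-k {k} k≢j = updateAt-minimal k j (entry u) k≢j

    -- The module hypotheses are what T2 and T3 ask of the new entry `c` at `j` together with the
    -- old entries of `u`.
    setEntry : ∃ λ v → entry v j ≡ c × (∀ k → k ≢ j → entry v k ≡ entry u k)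
    setEntry = record { entry = w ; T2 = w-T2 ; T3 = w-T3 } , w-j , λ _ → w-k
      where
      w-T2 : ∀ i → toℕ i ≡ 0 → w i ≢ 2F
      w-T2 i p q with i ≟ j
      ... | yes refl = t2 p (trans (sym w-j) q)
      ... | no i≢j = T2 u i p (trans (sym (w-k i≢j)) q)

      w-T3 : ∀ i k → i < k → w i ≡ 0F → w k ≢ 1F
      w-T3 i k i<k p q with i ≟ j | k ≟ j
      ... | yes refl | yes refl = ℕ.n≮n _ i<k
      ... | yes refl | no k≢j =
        zeroOK (trans (sym w-j) p) k i<k (trans (sym (w-k k≢j)) q)
      ... | no i≢j | yes refl =
        oneOK (trans (sym w-j) q) i i<k (trans (sym (w-k i≢j)) p)
      ... | no i≢j | no k≢j =
        T3 u i k i<k (trans (sym (w-k i≢j)) p) (trans (sym (w-k k≢j)) q)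

  one⇒nonzero-before : ∀ (u : Tri n) {t} → entry u t ≡ 1F → ∀ j → j ≤ t → entry u j ≢ 0F
  one⇒nonzero-before u {t} ut≡1 j j≤t uj≡0 with j ≟ t
  ... | yes refl = contradiction (trans (sym uj≡0) ut≡1) λ ()
  ... | no j≢t = T3 u j t (Fin.≤∧≢⇒< j≤t j≢t) uj≡0 ut≡1

  ones≤ : ∀ (u : Tri n) t → (∀ j → j ≤ t → entry u j ≢ 0F) → ones t ≤ᵀ u
  ones≤ u t nz j = flag-≤ (j ≤? t) (nz j)

  IsLeastWith : Fin n → Fin 3 → Pred (Tri n) 0ℓ
  IsLeastWith i c = IsMinimumOf (λ x → entry x i ≡ c)

  ones-least : ∀ t → IsLeastWith t 1F (ones t)
  ones-least t = flag-yes (t ≤? t) ℕ.≤-refl ,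
    λ x xt≡1 → ones≤ x t (one⇒nonzero-before x xt≡1)

  -- For the value 2, a single 2 at `i` among zeros is a triword, since T3 forbids only entries 1.
  -- The given `x` certifies through T2 that `i` is not the first position.
  leastWith : ∀ (x : Tri n) i c → entry x i ≡ c → c ≢ 0F → ∃ (IsLeastWith i c)
  leastWith x i 0F _ c≢0 = contradiction refl c≢0
  leastWith x i 1F _ _ = ones i , ones-least i
  leastWith x i 2F xi≡2 _
    with atom , at , off ← setEntry bottom i 2F (λ p _ → T2 x i p xi≡2) (λ _ _ _ ()) (λ ())
    = atom , at , least
    where
    least : ∀ y → entry y i ≡ 2F → atom ≤ᵀ y
    least y yi≡2 k with k ≟ i
    ... | yes refl = Fin.≤-reflexive (trans at (sym yi≡2))
    ... | no k≢i = subst (_≤ entry y k) (sym (off k k≢i)) z≤n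

  -- Let `i` be a position where `b` and `b′` differ, and `j` the least triword with entry `b′ i`
  -- there. Then `b ∨ j` exceeds `b` and stays below `b′`, so it is `b′` and `l ≤ j`. Conversely `l`
  -- has entry `b′ i` at `i`, because the maximum is not attained by `b`.
  label-irreducible : ∀ {b b′ l : Tri n} → b ⋖ b′ → IsLabel b b′ l →
    ∃ λ i → entry b′ i ≢ 0F × IsLeastWith i (entry b′ i) l
  label-irreducible {b} {b′} {l} ((b≤b′ , b≉b′) , none) (b∨l≈b′ , l-min)
    with i , bi≢ ← Fin.¬∀⟶∃¬ n _ (λ i → entry b i ≟ entry b′ i) b≉b′
    = i , b′i≢0 , li≡ , λ y yi≡ k → Fin.≤-trans (l≤j k) (j-min y yi≡ k)
    where
    b′i≢0 : entry b′ i ≢ 0F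
    b′i≢0 e = bi≢ (trans (≤0⇒≡0 (subst (entry b i ≤_) e (b≤b′ i))) (sym e))
    irr = leastWith b′ i (entry b′ i) refl b′i≢0
    j = proj₁ irr
    ji≡ = proj₁ (proj₂ irr)
    j-min = proj₂ (proj₂ irr)
    join-at : ∀ {x y} → x ⊔₃ y ≡ entry b′ i → x ≢ entry b′ i → y ≡ entry b′ i
    join-at {x} {y} e x≢ with Mx.⊔-sel x y
    ... | inj₁ p = contradiction (trans (sym p) e) x≢
    ... | inj₂ p = trans (sym p) e
    b∨j≤b′ : b ∨ᵀ j ≤ᵀ b′
    b∨j≤b′ k = Mx.⊔-lub (b≤b′ k) (j-min b′ refl k)
    b∨j≉b : ¬ b ≈ᵀ b ∨ᵀ j
    b∨j≉b e = bi≢ (Fin.≤-antisym (b≤b′ i)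
      (subst₂ _≤_ ji≡ (sym (e i)) (Mx.x≤y⊔x (entry b i) (entry j i))))
    b∨j≈b′ : b ∨ᵀ j ≈ᵀ b′
    b∨j≈b′ = decidable-stable (all? λ k → entry (b ∨ᵀ j) k ≟ entry b′ k) λ b∨j≉b′ →
      none (b ∨ᵀ j , ((λ k → Mx.x≤x⊔y (entry b k) (entry j k)) , b∨j≉b) , b∨j≤b′ , b∨j≉b′)
    l≤j = l-min j b∨j≈b′
    li≡ = join-at (b∨l≈b′ i) bi≢

  -- Suppose a lower cover `x` had a 0 at some `j ≤ t`. By T3 and `x ≤ u` its entry at `l` would be
  -- 0 as well, and `x ∨ ones t` would lie strictly between `x` and `u`: nonzero at `j`, but still 0
  -- at `l`.
  ones≤lowerCover : ∀ (u x : Tri n) {t l} → t < l → entry u l ≡ 1F → x ≈ᵀ u ⊎ x ⋖ u →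
                    ones t ≤ᵀ x
  ones≤lowerCover u x {t} {l} t<l ul≡1 (inj₁ x≈u) = ones≤ x t λ j j≤t xj≡0 →
    one⇒nonzero-before u ul≡1 j (ℕ.≤-trans j≤t (ℕ.<⇒≤ t<l)) (trans (sym (x≈u j)) xj≡0)
  ones≤lowerCover u x {t} {l} t<l ul≡1 (inj₂ ((x≤u , _) , none)) = ones≤ x t λ j j≤t xj≡0 →
    let xl≤1 = subst (entry x l ≤_) ul≡1 (x≤u l)
        y = x ∨ᵀ ones t
        yj≢0 : entry x j ≢ entry y j
        yj≢0 = λ e → contradiction (trans (sym xj≡0) e)
          λ e′ → contradiction (flag-yes (j ≤? t) j≤t) λ f →
          contradiction (≤0⇒≡0 (subst₂ _≤_ f (sym e′) (Mx.x≤y⊔x (entry x j) (entry (ones t) j)))) λ ()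
        yl≢ : entry y l ≢ entry u l
        yl≢ = λ e → case-l xl≤1 (T3 x j l (ℕ.≤-<-trans j≤t t<l) xj≡0)
                     (flag-no (l ≤? t) (ℕ.<⇒≱ t<l)) (trans e ul≡1)
    in none (y , ((λ k → Mx.x≤x⊔y (entry x k) (entry (ones t) k)) , λ e → yj≢0 (e j))
              , (λ k → Mx.⊔-lub (x≤u k) (ones≤u k)) , λ e → yl≢ (e l))
    where
    ones≤u : ones t ≤ᵀ u
    ones≤u = ones≤ u t λ j j≤t →
      one⇒nonzero-before u ul≡1 j (ℕ.≤-trans j≤t (ℕ.<⇒≤ t<l))
    case-l : ∀ {a b : Fin 3} → a ≤ suc (zero {1}) → a ≢ 1F → b ≡ 0F → a ⊔₃ b ≢ 1F
    case-l {0F} {0F} _ _ _ ()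
    case-l {1F} _ a≢1 _ _ = a≢1 refl
    case-l {2F} (s≤s ()) _ _ _

  InRun : Tri n → Pred (Fin n) 0ℓ
  InRun u t = (∀ j → j ≤ t → entry u j ≢ 0F) × (∀ j → t < j → entry u j ≢ 1F)

  ones-at : ∀ {x : Tri n} t → ones t ≤ᵀ x → entry x t ≢ 0F
  ones-at t ones≤x = ≢0-mono (ones≤x t)
    λ p → flag≡0 (t ≤? t) p ℕ.≤-refl

  AgreeOff : Fin n → Tri n → Tri n → Set
  AgreeOff j b b′ = ∀ k → k ≢ j → entry b k ≡ entry b′ k

  -- A triword between `b` and `b′` agrees with both off `j`, so its entry at `j` decides. The last
  -- hypothesis is about triwords rather than numbers because 0 to 2 can be a cover, namely when T3
  -- excludes 1 at `j`.
  cover-at : ∀ (b b′ : Tri n) j → AgreeOff j b b′ → entry b j < entry b′ j →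
    (∀ x → b ≤ᵀ x → x ≤ᵀ b′ → entry x j ≡ entry b j ⊎ entry x j ≡ entry b′ j) →
    b ⋖ b′
  cover-at b b′ j off bj<b′j gap = (b≤b′ , λ b≈b′ → Fin.<⇒≢ bj<b′j (b≈b′ j)) , none
    where
    b≤b′ : b ≤ᵀ b′
    b≤b′ k with k ≟ j
    ... | yes refl = ℕ.<⇒≤ bj<b′j
    ... | no k≢j = Fin.≤-reflexive (off k k≢j)
    none : ¬ ∃ λ x → (b ≤ᵀ x × ¬ b ≈ᵀ x) × (x ≤ᵀ b′ × ¬ x ≈ᵀ b′)
    none (x , (b≤x , b≉x) , (x≤b′ , x≉b′)) with gap x b≤x x≤b′
    ... | inj₁ xj≡bj = b≉x b≈x
      where
      b≈x : b ≈ᵀ x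
      b≈x k with k ≟ j
      ... | yes refl = sym xj≡bj
      ... | no k≢j = Fin.≤-antisym (b≤x k) (subst (entry x k ≤_) (sym (off k k≢j)) (x≤b′ k))
    ... | inj₂ xj≡b′j = x≉b′ x≈b′
      where
      x≈b′ : x ≈ᵀ b′
      x≈b′ k with k ≟ j
      ... | yes refl = xj≡b′j
      ... | no k≢j = Fin.≤-antisym (x≤b′ k) (subst (_≤ entry x k) (off k k≢j) (b≤x k))

  LowerCoverAt : Tri n → Fin n → Pred (Tri n) 0ℓ
  LowerCoverAt u j b = b ⋖ u × AgreeOff j b u × entry b j < entry u j

  -- Off `j` nothing is missing from `b`; at `j` a maximum above `b j` must come from the other
  -- argument. So `b ∨ x = u` forces `x` to have the entry `u j` at `j`.
  label-at : ∀ (u b l : Tri n) j → LowerCoverAt u j b → IsLeastWith j (entry u j) l →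
             IsLabel b u l
  label-at u b l j (((b≤u , _) , _) , off , bj<uj) (lj≡ , l-min) = b∨l≈u , least
    where
    u≤b∨l : u ≤ᵀ b ∨ᵀ l
    u≤b∨l k with k ≟ j
    ... | yes refl = subst (_≤ _) lj≡ (Mx.x≤y⊔x (entry b j) (entry l j))
    ... | no k≢j = subst (_≤ _) (off k k≢j) (Mx.x≤x⊔y (entry b k) (entry l k))
    b∨l≈u : b ∨ᵀ l ≈ᵀ u
    b∨l≈u k = Fin.≤-antisym (Mx.⊔-lub (b≤u k) (l-min u refl k)) (u≤b∨l k)
    least : ∀ x → b ∨ᵀ x ≈ᵀ u → l ≤ᵀ x
    least x e with Mx.⊔-sel (entry b j) (entry x j)
    ... | inj₁ p = contradiction (trans (sym p) (e j)) (Fin.<⇒≢ bj<uj)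
    ... | inj₂ p = l-min x (trans (sym p) (e j))

  -- If a 0 stands to the left of `j`, T3 excludes the value 1 and the 2 drops to 0; otherwise it
  -- drops to 1.
  lower-two : ∀ (u : Tri n) j → entry u j ≡ 2F → ∃ (LowerCoverAt u j)
  lower-two u j uj≡2 with any? (λ k → (k <? j) ×-dec (entry u k ≟ 0F))
  ... | yes (z , z<j , uz≡0)
    with b , at , off ← setEntry u j 0F (λ _ ())
           (λ _ k j<k → T3 u z k (Fin.<-trans z<j j<k) uz≡0) (λ ())
    = b , cover-at b u j off bj<uj gap , off , bj<uj
    where
    bj<uj : entry b j < entry u j
    bj<uj = subst₂ _<_ (sym at) (sym uj≡2) (s≤s z≤n)
    gap : ∀ x → b ≤ᵀ x → x ≤ᵀ u → entry x j ≡ entry b j ⊎ entry x j ≡ entry u j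
    gap x _ x≤u with entry x j ≟ 0F
    ... | yes xj≡0 = inj₁ (trans xj≡0 (sym at))
    ... | no xj≢0 = inj₂ (trans (≢0∧≢1⇒≡2 xj≢0
            (T3 x z j z<j (≤0⇒≡0 (subst (entry x z ≤_) uz≡0 (x≤u z))))) (sym uj≡2))
  ... | no ¬z
    with b , at , off ← setEntry u j 1F (λ _ ()) (λ ()) (λ _ k k<j p → ¬z (k , k<j , p))
    = b , cover-at b u j off bj<uj gap , off , bj<uj
    where
    bj<uj : entry b j < entry u j
    bj<uj = subst₂ _<_ (sym at) (sym uj≡2) (s≤s (s≤s z≤n))
    gap : ∀ x → b ≤ᵀ x → x ≤ᵀ u → entry x j ≡ entry b j ⊎ entry x j ≡ entry u j
    gap x b≤x _ with entry x j ≟ 1F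
    ... | yes xj≡1 = inj₁ (trans xj≡1 (sym at))
    ... | no xj≢1 = inj₂ (trans (≢0∧≢1⇒≡2
            (≢0-mono (b≤x j) λ p → contradiction (trans (sym at) p) λ ()) xj≢1) (sym uj≡2))

  -- T3 prevents a 1 from dropping to 0 while another 1 stands to its right; the last 1 is free to
  -- drop.
  lower-one : ∀ (u : Tri n) l → entry u l ≡ 1F → (∀ j → l < j → entry u j ≢ 1F) →
              ∃ (LowerCoverAt u l)
  lower-one u l ul≡1 last-l
    with b , at , off ← setEntry u l 0F (λ _ ()) (λ _ → last-l) (λ ())
    = b , cover-at b u l off bl<ul gap , off , bl<ul
    where
    bl<ul : entry b l < entry u l
    bl<ul = subst₂ _<_ (sym at) (sym ul≡1) (s≤s z≤n)
    gap : ∀ x → b ≤ᵀ x → x ≤ᵀ u → entry x l ≡ entry b l ⊎ entry x l ≡ entry u l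
    gap x _ x≤u with ≤1⇒≡0⊎≡1 (subst (entry x l ≤_) ul≡1 (x≤u l))
    ... | inj₁ p = inj₁ (trans p (sym at))
    ... | inj₂ p = inj₂ (trans p (sym ul≡1))

  lastOne : ∀ (u : Tri n) i → entry u i ≡ 1F → ∃ λ l → i ≤ l × entry u l ≡ 1F × InRun u l
  lastOne u i ui≡1 with last (λ k → entry u k ≟ 1F) (i , ui≡1)
  ... | l , ul≡1 , l-max =
    l , ℕ.≮⇒≥ (λ l<i → l-max i l<i ui≡1) , ul≡1 , one⇒nonzero-before u ul≡1 , l-max

  nucleus-correct : ∀ u → IsNucleus u (nucleus u)
  nucleus-correct u = lower , greatest
    where
    lower : ∀ x → x ≈ᵀ u ⊎ x ⋖ u → nucleus u ≤ᵀ x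
    lower x hx j = flag-≤ (oneBeyond? u j) λ (l , j<l , ul≡1) →
      ones-at {x} j (ones≤lowerCover u x j<l ul≡1 hx)
    greatest : ∀ y → (∀ x → x ≈ᵀ u ⊎ x ⋖ u → y ≤ᵀ x) → y ≤ᵀ nucleus u
    greatest y hy j = go (entry y j) refl
      where
      y≤u : y ≤ᵀ u
      y≤u = hy u (inj₁ λ _ → refl)
      -- Here `n` is a variable, so the first position has to be extracted from the existence of
      -- `j`.
      first : ∀ {m} → Fin m → ∃ λ (z : Fin m) → toℕ z ≡ 0
      first {suc m} _ = zero , refl
      go : ∀ c → entry y j ≡ c → c ≤ entry (nucleus u) j
      go 0F _ = z≤n
      go 1F yj≡1 with oneBeyond? u j
      ... | yes _ = ℕ.≤-refl
      ... | no ¬beyond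
        -- As `y` is nonzero up to `j`, the first entry of `u` is nonzero, hence 1 by T2, and `u`
        -- has a last 1, at `l`. By `¬beyond`, `l ≤ j`. The lower cover with 0 at `l` forces `y` to
        -- be 0 at `l`, against T3 and `yj≡1`.
        with z , z≡0 ← first j
        with l , _ , ul≡1 , _ , l-max ← lastOne u z (decidable-stable (entry u z ≟ 1F) λ uz≢1 →
               T2 u z z≡0 (≢0∧≢1⇒≡2 (≢0-mono (y≤u z)
                 (one⇒nonzero-before y yj≡1 z (subst (λ k → k ℕ.≤ toℕ j) (sym z≡0) z≤n))) uz≢1))
        with b , b⋖u , _ , bl<ul ← lower-one u l ul≡1 l-max
        = contradiction (ℕ.≤-<-trans (hy b (inj₂ b⋖u) l) bl<ul)
            λ yl<ul → one⇒nonzero-before y yj≡1 l (ℕ.≮⇒≥ λ j<l → ¬beyond (l , j<l , ul≡1))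
              (<1⇒≡0 (subst (entry y l <_) ul≡1 yl<ul))
        where
        <1⇒≡0 : {x : Fin 3} → x < suc (zero {1}) → x ≡ 0F
        <1⇒≡0 {0F} _ = refl
        <1⇒≡0 {suc _} (s≤s ())
      go 2F yj≡2
        with uj≡2 ← ≥2⇒≡2 (subst (_≤ entry u j) yj≡2 (y≤u j))
        with b , b⋖u , _ , bj<uj ← lower-two u j uj≡2
        = contradiction (subst (entry b j <_) (trans uj≡2 (sym yj≡2)) bj<uj)
            (ℕ.≤⇒≯ (hy b (inj₂ b⋖u) j))

  -- Membership in core label sets.

  Ψ-two : ∀ (u : Tri n) {i l} → entry u i ≡ 2F → IsLeastWith i 2F l → Ψ u l
  Ψ-two u {i} {l} ui≡2 least with lower-two u i ui≡2
  ... | b , low@(b⋖u , _) =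
    nucleus u , b , u , nucleus-correct u , proj₁ (nucleus-correct u) b (inj₂ b⋖u) ,
    b⋖u , (λ _ → ℕ.≤-refl) , label-at u b l i low (subst (λ c → IsLeastWith i c l) (sym ui≡2) least)

  -- The cover taken has `ones t` on top instead of `u`; its bottom `b` changes the entry at `t`
  -- only. Since `u` has no 1 beyond `t`, the ones of the nucleus lie strictly before `t`, so the
  -- nucleus is below `b`.
  Ψ-one : ∀ (u : Tri n) {t l} → InRun u t → IsLeastWith t 1F l → Ψ u l
  Ψ-one u {t} {l} (nz , no1) least
    with lower-one (ones t) t (proj₁ (ones-least t))
           (λ j t<j p → ℕ.<⇒≱ t<j (flag≡1 (j ≤? t) p))
  ... | b , low@(b⋖ones , off , _) =
    nucleus u , b , ones t , nucleus-correct u , nucleus≤b , b⋖ones , ones≤ u t nz ,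
    label-at (ones t) b l t low (subst (λ c → IsLeastWith t c l) (sym (proj₁ (ones-least t))) least)
    where
    nucleus≤b : nucleus u ≤ᵀ b
    nucleus≤b k = flag-≤ (oneBeyond? u k) λ (m , k<m , um≡1) →
      let k<t = ℕ.<-≤-trans k<m (ℕ.≮⇒≥ λ t<m → no1 m t<m um≡1) in
      λ bk≡0 → flag≡0 (k ≤? t) (trans (sym (off k (Fin.<⇒≢ k<t))) bk≡0) (ℕ.<⇒≤ k<t)

  Ψ-elim : ∀ (u : Tri n) {l} → Ψ u l →
    (∃ λ i → entry u i ≡ 2F × IsLeastWith i 2F l) ⊎ (∃ λ t → InRun u t × IsLeastWith t 1F l)
  Ψ-elim u {l} (d , b , b′ , (_ , d-greatest) , d≤b , b⋖b′@((b≤b′ , b≉b′) , _) ,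
                b′≤u , label@(b∨l≈b′ , _))
    with label-irreducible {b} {b′} {l} b⋖b′ label
  ... | i , b′i≢0 , least = go (entry b′ i) b′i≢0 least
    where
    l≤b′ : l ≤ᵀ b′
    l≤b′ k = subst (entry l k ≤_) (b∨l≈b′ k) (Mx.x≤y⊔x (entry b k) (entry l k))
    l≤u : l ≤ᵀ u
    l≤u k = Fin.≤-trans (l≤b′ k) (b′≤u k)
    go : ∀ c → c ≢ 0F → IsLeastWith i c l →
      (∃ λ i → entry u i ≡ 2F × IsLeastWith i 2F l) ⊎ (∃ λ t → InRun u t × IsLeastWith t 1F l)
    go 0F 0≢0 _ = contradiction refl 0≢0
    go 2F _ least = inj₁ (i , ≥2⇒≡2 (subst (_≤ entry u i) (proj₁ least) (l≤u i)) , least)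
    go 1F _ least@(li≡1 , l-min) = inj₂ (i , (nz , no1) , least)
      where
      nz : ∀ j → j ≤ i → entry u j ≢ 0F
      nz j j≤i = ≢0-mono (l≤u j) (one⇒nonzero-before l li≡1 j j≤i)
      no1 : ∀ j → i < j → entry u j ≢ 1F
      -- With a 1 of `u` beyond `i`, `ones i` is below every lower cover of `u`, hence below the
      -- nucleus `d` and below `b`. Then `l ≤ ones i ≤ b`, and joining `l` to `b` could not reach
      -- `b′`.
      no1 j i<j uj≡1 = b≉b′ λ k → Fin.≤-antisym (b≤b′ k)
        (subst (_≤ entry b k) (b∨l≈b′ k) (Mx.⊔-lub Fin.≤-refl (l≤b k)))
        where
        l≤b : l ≤ᵀ b
        l≤b k = Fin.≤-trans (l-min (ones i) (proj₁ (ones-least i)) k)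
          (Fin.≤-trans (d-greatest (ones i) (λ x → ones≤lowerCover u x i<j uj≡1) k) (d≤b k))

  Ψ⇒≤ : ∀ (u : Tri n) {l} → Ψ u l → l ≤ᵀ u
  Ψ⇒≤ u {l} p with Ψ-elim u {l} p
  ... | inj₁ (_ , ui≡2 , _ , l-min) = l-min u ui≡2
  ... | inj₂ (t , (nz , _) , _ , l-min) = λ k →
    Fin.≤-trans (l-min (ones t) (proj₁ (ones-least t)) k) (ones≤ u t nz k)

  -- `Ψ-elim` only provides some `s` for which `ones t` is least with entry 1. That entry gives
  -- `s ≤ t`, and leastness against `ones s` gives `t ≤ s`.
  Ψ-ones⇒InRun : ∀ (u : Tri n) t → Ψ u (ones t) → InRun u t
  Ψ-ones⇒InRun u t p with Ψ-elim u {ones t} p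
  ... | inj₁ (i , _ , ones≡2 , _) = contradiction ones≡2 (flag≢2 (i ≤? t))
  ... | inj₂ (s , run , ones≡1 , l-min) = subst (InRun u) (Fin.≤-antisym s≤t t≤s) run
    where
    s≤t : s ≤ t
    s≤t = flag≡1 (s ≤? t) ones≡1
    t≤s : t ≤ s
    t≤s = decidable-stable (t ≤? s) λ t≰s → ones-at {ones s} t
      (l-min (ones s) (proj₁ (ones-least s))) (flag-no (t ≤? s) t≰s)

-- The core label order in terms of entries.

module _ {m : ℕ} where
  open CoreLabelOrder (Hoch (suc m))

  infix 4 _⊴_

  _⊴_ : Tri (suc m) → Tri (suc m) → Set
  u ⊴ v = (∀ i → entry u i ≡ 2F → entry v i ≡ 2F)
        × (entry u 0F ≡ 1F → ∀ i → entry v i ≡ 2F ⊎ entry v i ≡ entry u i)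

  ⊑⇒⊴ : ∀ u v → u ⊑ v → u ⊴ v
  ⊑⇒⊴ u v u⊑v = twos , agree
    where
    twos : ∀ i → entry u i ≡ 2F → entry v i ≡ 2F
    twos i ui≡2 =
      let l , least = leastWith u i 2F ui≡2 (λ ())
      in ≥2⇒≡2 (subst (_≤ entry v i) (proj₁ least)
           (Ψ⇒≤ v {l} (u⊑v {l} (Ψ-two u {i} {l} ui≡2 least)) i))
    -- Let `l` be the last 1 of `u`. The label `ones l` passes from `u` to `v`, so both triwords
    -- have entries 1 or 2 up to `l` and 0 or 2 beyond.
    agree : entry u 0F ≡ 1F → ∀ i → entry v i ≡ 2F ⊎ entry v i ≡ entry u i
    agree u0≡1 i = go (entry u i) (entry v i) refl refl
      where
      ∃last = lastOne u 0F u0≡1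
      l = proj₁ ∃last
      run : InRun u l
      run = proj₂ (proj₂ (proj₂ ∃last))
      run′ : InRun v l
      run′ = Ψ-ones⇒InRun v l (u⊑v {ones l} (Ψ-one u {l} {ones l} run (ones-least l)))
      go : ∀ a b → entry u i ≡ a → entry v i ≡ b → b ≡ 2F ⊎ b ≡ a
      go _ 2F _ _ = inj₁ refl
      go 0F 0F _ _ = inj₂ refl
      go 1F 1F _ _ = inj₂ refl
      go 2F 0F p q = contradiction (trans (sym q) (twos i p)) λ ()
      go 2F 1F p q = contradiction (trans (sym q) (twos i p)) λ ()
      go 0F 1F p q = contradiction q (proj₂ run′ i (ℕ.≰⇒> λ i≤l → proj₁ run i i≤l p))
      go 1F 0F p q = contradiction q (proj₁ run′ i (ℕ.≮⇒≥ λ l<i → proj₂ run i l<i p))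

  ⊴⇒⊑ : ∀ u v → u ⊴ v → u ⊑ v
  ⊴⇒⊑ u v (twos , agree) {l} p with Ψ-elim u {l} p
  ... | inj₁ (i , ui≡2 , least) = Ψ-two v {i} {l} (twos i ui≡2) least
  ... | inj₂ (t , (nz , no1) , least) = Ψ-one v {t} {l} (nz′ , no1′) least
    where
    -- A label of the second kind makes the first entry of `u` nonzero, hence 1 by T2, which unlocks
    -- `agree`.
    agree′ = agree (decidable-stable (entry u 0F ≟ 1F) λ u0≢1 →
      T2 u 0F refl (≢0∧≢1⇒≡2 (nz 0F z≤n) u0≢1))
    nz′ : ∀ j → j ≤ t → entry v j ≢ 0F
    nz′ j j≤t vj≡0 with agree′ j
    ... | inj₁ q = contradiction (trans (sym vj≡0) q) λ ()
    ... | inj₂ q = nz j j≤t (trans (sym q) vj≡0)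
    no1′ : ∀ j → t < j → entry v j ≢ 1F
    no1′ j t<j vj≡1 with agree′ j
    ... | inj₁ q = contradiction (trans (sym vj≡1) q) λ ()
    ... | inj₂ q = no1 j t<j (trans (sym q) vj≡1)

  -- If one of the first entries is 1, the agreement clause settles all positions. If both are 0, T3
  -- excludes 1 everywhere, and the positions of the 2s determine the triword.
  ⊴-antisym : ∀ u v → u ⊴ v → v ⊴ u → u ≈ᵀ v
  ⊴-antisym u v (twos , agree) (twos′ , agree′) i
    with entry u 0F in u0 | entry v 0F in v0
  ... | 2F | _ = contradiction u0 (T2 u 0F refl)
  ... | _ | 2F = contradiction v0 (T2 v 0F refl)
  ... | 1F | _ with agree refl i
  ...   | inj₁ vi≡2 = trans (twos′ i vi≡2) (sym vi≡2)
  ...   | inj₂ e = sym e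
  ⊴-antisym u v (twos , agree) (twos′ , agree′) i
      | 0F | 1F with agree′ refl i
  ...   | inj₁ ui≡2 = trans ui≡2 (sym (twos i ui≡2))
  ...   | inj₂ e = e
  ⊴-antisym u v (twos , agree) (twos′ , agree′) i
      | 0F | 0F = go (entry u i) (entry v i) refl refl
    where
    no1 : ∀ (w : Tri (suc m)) → entry w 0F ≡ 0F → ∀ j → entry w j ≢ 1F
    no1 w w0 j wj≡1 = one⇒nonzero-before w wj≡1 0F z≤n w0
    go : ∀ a b → entry u i ≡ a → entry v i ≡ b → a ≡ b
    go 0F 0F _ _ = refl
    go 2F 2F _ _ = refl
    go 0F 2F p q = trans (sym p) (twos′ i q)
    go 2F 0F p q = trans (sym (twos i p)) q
    go 1F _ p _ = contradiction p (no1 u u0 i)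
    go _ 1F _ q = contradiction q (no1 v v0 i)

-- Words built from entries, and steps between them.

-- g lists the entries u₂, u₃, … and h the letters they stand for.  wordBefore is
-- read while b is still to come, wordAfter once it has passed or if there is
-- none; in the latter situation T3 excludes the entry 1, whose value is junk.
wordAfter : ∀ {k m} → (Fin k → Fin m) → Vector (Fin 3) k → Word m 1
wordAfter {zero}  h g = []
wordAfter {suc k} h g with g 0F
... | 0F = inj₁ (h 0F) ∷ wordAfter (h ∘ suc) (g ∘ suc)
... | _  = wordAfter (h ∘ suc) (g ∘ suc)

wordBefore : ∀ {k m} → (Fin k → Fin m) → Vector (Fin 3) k → Word m 1
wordBefore {zero}  h g = inj₂ 0F ∷ []
wordBefore {suc k} h g with g 0F
... | 0F = inj₂ 0F ∷ inj₁ (h 0F) ∷ wordAfter (h ∘ suc) (g ∘ suc)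
... | 1F = inj₁ (h 0F) ∷ wordBefore (h ∘ suc) (g ∘ suc)
... | 2F = wordBefore (h ∘ suc) (g ∘ suc)

NoOneAfterZero : ∀ {k} → Vector (Fin 3) k → Set
NoOneAfterZero g = ∀ i j → i < j → g i ≡ 0F → g j ≢ 1F

noOneAfterZero-tail : ∀ {k} {g : Vector (Fin 3) (suc k)} →
                      NoOneAfterZero g → NoOneAfterZero (g ∘ suc)
noOneAfterZero-tail t i j i<j = t (suc i) (suc j) (s≤s i<j)

noOneAfterZero-cons : ∀ {k} c {g : Vector (Fin 3) k} → (c ≡ 0F → ∀ i → g i ≢ 1F) →
                      NoOneAfterZero g → NoOneAfterZero (c Vector.∷ g)
noOneAfterZero-cons c no1 t zero    (suc j) _         c≡0 = no1 c≡0 j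
noOneAfterZero-cons c no1 t (suc i) (suc j) (s≤s i<j) = t i j i<j

module _ {m : ℕ} where

  private variable
    k : ℕ
    h : Fin k → Fin m
    g g′ : Vector (Fin 3) k
    a : Fin m
    w w′ : Word m 1

  wordAfter-cong : ∀ (h : Fin k → Fin m) → (∀ i → g i ≡ g′ i) → wordAfter h g ≡ wordAfter h g′
  wordAfter-cong {zero} h e = refl
  wordAfter-cong {suc k} {g} {g′} h e with g 0F | g′ 0F | e 0F
  ... | 0F | _ | refl = cong (_ ∷_) (wordAfter-cong (h ∘ suc) (e ∘ suc))
  ... | 1F | _ | refl = wordAfter-cong (h ∘ suc) (e ∘ suc)
  ... | 2F | _ | refl = wordAfter-cong (h ∘ suc) (e ∘ suc)

  wordBefore-cong : ∀ (h : Fin k → Fin m) → (∀ i → g i ≡ g′ i) → wordBefore h g ≡ wordBefore h g′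
  wordBefore-cong {zero} h e = refl
  wordBefore-cong {suc k} {g} {g′} h e with g 0F | g′ 0F | e 0F
  ... | 0F | _ | refl = cong (λ w → _ ∷ _ ∷ w) (wordAfter-cong (h ∘ suc) (e ∘ suc))
  ... | 1F | _ | refl = cong (_ ∷_) (wordBefore-cong (h ∘ suc) (e ∘ suc))
  ... | 2F | _ | refl = wordBefore-cong (h ∘ suc) (e ∘ suc)

  wordAfter-A : ∀ (h : Fin k → Fin m) g → mapMaybe isInj₁ (wordAfter h g) ⊆ tabulate h
  wordAfter-A {zero} h g = []
  wordAfter-A {suc k} h g with g 0F
  ... | 0F = refl ∷ wordAfter-A (h ∘ suc) _
  ... | 1F = _ ∷ʳ wordAfter-A (h ∘ suc) _
  ... | 2F = _ ∷ʳ wordAfter-A (h ∘ suc) _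

  wordBefore-A : ∀ (h : Fin k → Fin m) g → mapMaybe isInj₁ (wordBefore h g) ⊆ tabulate h
  wordBefore-A {zero} h g = []
  wordBefore-A {suc k} h g with g 0F
  ... | 0F = refl ∷ wordAfter-A (h ∘ suc) _
  ... | 1F = refl ∷ wordBefore-A (h ∘ suc) _
  ... | 2F = _ ∷ʳ wordBefore-A (h ∘ suc) _

  wordAfter-B : ∀ (h : Fin k → Fin m) g → mapMaybe isInj₂ (wordAfter h g) ≡ []
  wordAfter-B {zero} h g = refl
  wordAfter-B {suc k} h g with g 0F
  ... | 0F = wordAfter-B (h ∘ suc) _
  ... | 1F = wordAfter-B (h ∘ suc) _
  ... | 2F = wordAfter-B (h ∘ suc) _

  wordBefore-B : ∀ (h : Fin k → Fin m) g → mapMaybe isInj₂ (wordBefore h g) ≡ 0F ∷ []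
  wordBefore-B {zero} h g = refl
  wordBefore-B {suc k} h g with g 0F
  ... | 0F = cong (0F ∷_) (wordAfter-B (h ∘ suc) _)
  ... | 1F = wordBefore-B (h ∘ suc) _
  ... | 2F = wordBefore-B (h ∘ suc) _

  -- Only entries 2 can precede the first 0, and these produce no letter, so b comes out first.
  wordBefore-noOne : ∀ (h : Fin k → Fin m) g → (∀ i → g i ≢ 1F) →
                     wordBefore h g ≡ inj₂ 0F ∷ wordAfter h g
  wordBefore-noOne {zero} h g no1 = refl
  wordBefore-noOne {suc k} h g no1 with g 0F in g0
  ... | 0F = refl
  ... | 1F = contradiction g0 (no1 0F)
  ... | 2F = wordBefore-noOne (h ∘ suc) _ (no1 ∘ suc)

  under : ∀ x → Star _⟶_ w w′ → Star _⟶_ (x ∷ w) (x ∷ w′)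
  under x = gmap (x ∷_) there

  after⟶*after : ∀ (h : Fin k → Fin m) g g′ → (∀ i → g′ i ≡ 0F → g i ≡ 0F) →
                 Star _⟶_ (wordAfter h g) (wordAfter h g′)
  after⟶*after {zero} h g g′ p = ε
  after⟶*after {suc k} h g g′ p with g 0F | g′ 0F | p 0F
  ... | 0F | 0F | _ = under _ (after⟶*after (h ∘ suc) _ _ (p ∘ suc))
  ... | 0F | 1F | _ = remove ◅ after⟶*after (h ∘ suc) _ _ (p ∘ suc)
  ... | 0F | 2F | _ = remove ◅ after⟶*after (h ∘ suc) _ _ (p ∘ suc)
  ... | 1F | 0F | q = contradiction (q refl) λ ()
  ... | 1F | 1F | _ = after⟶*after (h ∘ suc) _ _ (p ∘ suc)
  ... | 1F | 2F | _ = after⟶*after (h ∘ suc) _ _ (p ∘ suc)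
  ... | 2F | 0F | q = contradiction (q refl) λ ()
  ... | 2F | 1F | _ = after⟶*after (h ∘ suc) _ _ (p ∘ suc)
  ... | 2F | 2F | _ = after⟶*after (h ∘ suc) _ _ (p ∘ suc)

  after⟶*before : ∀ (h : Fin k → Fin m) g g′ → (∀ i → g′ i ≢ 2F → g i ≡ 0F) →
                  Star _⟶_ (wordAfter h g) (wordBefore h g′)
  after⟶*before {zero} h g g′ p = add ◅ ε
  after⟶*before {suc k} h g g′ p with g 0F | g′ 0F | p 0F
  -- The first 0 of `g′` is where b belongs; from here on letters are only removed.
  ... | 0F | 0F | _ = add ◅ under _ (under _ (after⟶*after (h ∘ suc) _ _
                        λ i q → p (suc i) λ r → contradiction (trans (sym q) r) λ ()))
  ... | 0F | 1F | _ = under _ (after⟶*before (h ∘ suc) _ _ (p ∘ suc))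
  ... | 0F | 2F | _ = remove ◅ after⟶*before (h ∘ suc) _ _ (p ∘ suc)
  ... | 1F | 2F | _ = after⟶*before (h ∘ suc) _ _ (p ∘ suc)
  ... | 2F | 2F | _ = after⟶*before (h ∘ suc) _ _ (p ∘ suc)
  ... | suc _ | 0F | q = contradiction (q λ ()) λ ()
  ... | suc _ | 1F | q = contradiction (q λ ()) λ ()

  before⟶*before : ∀ (h : Fin k → Fin m) g g′ → NoOneAfterZero g →
                   (∀ i → g′ i ≡ 2F ⊎ g′ i ≡ g i) →
                   Star _⟶_ (wordBefore h g) (wordBefore h g′)
  before⟶*before {zero} h g g′ t p = ε
  before⟶*before {suc k} h g g′ t p with g 0F in g0 | g′ 0F | p 0F
  ... | 0F | _ | inj₂ refl = under _ (under _ (after⟶*after (h ∘ suc) _ _ (agree0 ∘ suc)))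
    where
    agree0 : ∀ i → g′ i ≡ 0F → g i ≡ 0F
    agree0 i q with p i
    ... | inj₁ r = contradiction (trans (sym q) r) λ ()
    ... | inj₂ r = trans (sym r) q
  ... | 1F | _ | inj₂ refl = under _ (before⟶*before (h ∘ suc) _ _ (noOneAfterZero-tail t) (p ∘ suc))
  ... | 2F | _ | inj₂ refl = before⟶*before (h ∘ suc) _ _ (noOneAfterZero-tail t) (p ∘ suc)
  ... | 1F | _ | inj₁ refl = remove ◅ before⟶*before (h ∘ suc) _ _ (noOneAfterZero-tail t) (p ∘ suc)
  ... | 2F | _ | inj₁ refl = before⟶*before (h ∘ suc) _ _ (noOneAfterZero-tail t) (p ∘ suc)
  -- In the source, b stands just in front of the letter to be removed, whereas `wordBefore` on the
  -- target still looks for a place for b. No 1 is left, so that place is the head.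
  ... | 0F | _ | inj₁ refl =
    subst (Star _⟶_ _) (sym (wordBefore-noOne (h ∘ suc) _ no1))
      (there remove ◅ under _ (after⟶*after (h ∘ suc) _ _ agree0))
    where
    no1 : ∀ i → g′ (suc i) ≢ 1F
    no1 i q with p (suc i)
    ... | inj₁ r = contradiction (trans (sym q) r) λ ()
    ... | inj₂ r = t 0F (suc i) (s≤s z≤n) g0 (trans (sym r) q)
    agree0 : ∀ i → g′ (suc i) ≡ 0F → g (suc i) ≡ 0F
    agree0 i q with p (suc i)
    ... | inj₁ r = contradiction (trans (sym q) r) λ ()
    ... | inj₂ r = trans (sym r) q

  -- Properties of words reflected by every step.

  data NoB : Word m 1 → Set where
    []  : NoB []
    _∷_ : ∀ a → NoB w → NoB (inj₁ a ∷ w)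

  -- In front of every b, respectively behind every b; both hold for every
  -- letter of A if there is no b.
  data InFront (a : Fin m) : Word m 1 → Set where
    here  : InFront a (inj₁ a ∷ w)
    there : ∀ {x} → InFront a w → InFront a (inj₁ x ∷ w)

  data Behind (a : Fin m) : Word m 1 → Set where
    here  : NoB w → Behind a (inj₁ a ∷ w)
    there : ∀ {x} → Behind a w → Behind a (x ∷ w)

  -- `add` needs no clause here or in `inFront-⟵`: a word that begins with b is not free of b and
  -- has no letter in front of it.
  noB-⟵ : w ⟶ w′ → NoB w′ → NoB w
  noB-⟵ remove    p       = _ ∷ p
  noB-⟵ (there s) (a ∷ p) = a ∷ noB-⟵ s p

  inFront-⟵ : w ⟶ w′ → InFront a w′ → InFront a w
  inFront-⟵ remove    p         = there p
  inFront-⟵ (there s) here      = here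
  inFront-⟵ (there s) (there p) = there (inFront-⟵ s p)

  behind-⟵ : w ⟶ w′ → Behind a w′ → Behind a w
  behind-⟵ remove    p         = there p
  behind-⟵ add       (there p) = p
  behind-⟵ (there s) (here p)  = here (noB-⟵ s p)
  behind-⟵ (there s) (there p) = there (behind-⟵ s p)

  antitone* : {P : Word m 1 → Set} → (∀ {w w′} → w ⟶ w′ → P w′ → P w) →
       Star _⟶_ w w′ → P w′ → P w
  antitone* {P = P} step = fold (λ w w′ → P w′ → P w) (λ s f → step s ∘ f) id

  inFront⇒∈ : InFront a w → inj₁ a ∈ w
  inFront⇒∈ here      = here refl
  inFront⇒∈ (there p) = there (inFront⇒∈ p)

  behind⇒∈ : Behind a w → inj₁ a ∈ w
  behind⇒∈ (here _)  = here refl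
  behind⇒∈ (there p) = there (behind⇒∈ p)

  noB-wordAfter : ∀ (h : Fin k → Fin m) g → NoB (wordAfter h g)
  noB-wordAfter {zero} h g = []
  noB-wordAfter {suc k} h g with g 0F
  ... | 0F = _ ∷ noB-wordAfter (h ∘ suc) _
  ... | 1F = noB-wordAfter (h ∘ suc) _
  ... | 2F = noB-wordAfter (h ∘ suc) _

  ¬noB-wordBefore : ∀ (h : Fin k → Fin m) g → ¬ NoB (wordBefore h g)
  ¬noB-wordBefore {suc k} h g p with g 0F
  ¬noB-wordBefore {suc k} h g (_ ∷ p) | 1F = ¬noB-wordBefore (h ∘ suc) _ p
  ¬noB-wordBefore {suc k} h g p       | 2F = ¬noB-wordBefore (h ∘ suc) _ p

  ∈-wordAfter⁻ : ∀ (h : Fin k → Fin m) g → inj₁ a ∈ wordAfter h g → ∃ λ i → h i ≡ a × g i ≡ 0F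
  ∈-wordAfter⁻ {suc k} h g p with g 0F in g0
  ∈-wordAfter⁻ {suc k} h g (here refl) | 0F = 0F , refl , g0
  ∈-wordAfter⁻ {suc k} h g (there p) | 0F with i , r ← ∈-wordAfter⁻ (h ∘ suc) _ p = suc i , r
  ∈-wordAfter⁻ {suc k} h g p | 1F with i , r ← ∈-wordAfter⁻ (h ∘ suc) _ p = suc i , r
  ∈-wordAfter⁻ {suc k} h g p | 2F with i , r ← ∈-wordAfter⁻ (h ∘ suc) _ p = suc i , r

  inFront-wordBefore⁻ : ∀ (h : Fin k → Fin m) g → InFront a (wordBefore h g) →
                        ∃ λ i → h i ≡ a × g i ≡ 1F
  inFront-wordBefore⁻ {suc k} h g p with g 0F in g0
  inFront-wordBefore⁻ {suc k} h g here | 1F = 0F , refl , g0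
  inFront-wordBefore⁻ {suc k} h g (there p) | 1F
    with i , r ← inFront-wordBefore⁻ (h ∘ suc) _ p = suc i , r
  inFront-wordBefore⁻ {suc k} h g p | 2F
    with i , r ← inFront-wordBefore⁻ (h ∘ suc) _ p = suc i , r

  behind-wordBefore⁻ : ∀ (h : Fin k → Fin m) g → Behind a (wordBefore h g) →
                       ∃ λ i → h i ≡ a × g i ≡ 0F
  behind-wordBefore⁻ {zero} h g (there ())
  behind-wordBefore⁻ {suc k} h g p with g 0F in g0
  behind-wordBefore⁻ {suc k} h g (there (here _)) | 0F = 0F , refl , g0
  behind-wordBefore⁻ {suc k} h g (there (there p)) | 0F
    with i , r ← ∈-wordAfter⁻ (h ∘ suc) _ (behind⇒∈ p) = suc i , r
  -- The letter of an entry 1 is written while b is still to come.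
  behind-wordBefore⁻ {suc k} h g (here p) | 1F = contradiction p (¬noB-wordBefore (h ∘ suc) _)
  behind-wordBefore⁻ {suc k} h g (there p) | 1F
    with i , r ← behind-wordBefore⁻ (h ∘ suc) _ p = suc i , r
  behind-wordBefore⁻ {suc k} h g p | 2F
    with i , r ← behind-wordBefore⁻ (h ∘ suc) _ p = suc i , r

  behind-wordAfter⁺ : ∀ (h : Fin k → Fin m) g i → g i ≡ 0F → Behind (h i) (wordAfter h g)
  behind-wordAfter⁺ {suc k} h g zero p with 0F ← g 0F = here (noB-wordAfter (h ∘ suc) _)
  behind-wordAfter⁺ {suc k} h g (suc i) p with g 0F
  ... | 0F = there (behind-wordAfter⁺ (h ∘ suc) _ i p)
  ... | 1F = behind-wordAfter⁺ (h ∘ suc) _ i p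
  ... | 2F = behind-wordAfter⁺ (h ∘ suc) _ i p

  behind-wordBefore⁺ : ∀ (h : Fin k → Fin m) g i → g i ≡ 0F → Behind (h i) (wordBefore h g)
  behind-wordBefore⁺ {suc k} h g zero p with 0F ← g 0F = there (here (noB-wordAfter (h ∘ suc) _))
  behind-wordBefore⁺ {suc k} h g (suc i) p with g 0F
  ... | 0F = there (there (behind-wordAfter⁺ (h ∘ suc) _ i p))
  ... | 1F = there (behind-wordBefore⁺ (h ∘ suc) _ i p)
  ... | 2F = behind-wordBefore⁺ (h ∘ suc) _ i p

  inFront-wordBefore⁺ : ∀ (h : Fin k → Fin m) g → NoOneAfterZero g → ∀ i → g i ≡ 1F →
                        InFront (h i) (wordBefore h g)
  inFront-wordBefore⁺ {suc k} h g t zero p with 1F ← g 0F = here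
  inFront-wordBefore⁺ {suc k} h g t (suc i) p with g 0F in g0
  ... | 0F = contradiction p (t 0F (suc i) (s≤s z≤n) g0)
  ... | 1F = there (inFront-wordBefore⁺ (h ∘ suc) _ (noOneAfterZero-tail t) i p)
  ... | 2F = inFront-wordBefore⁺ (h ∘ suc) _ (noOneAfterZero-tail t) i p

  -- Recovering entries from a word.

  wordAfter-surjective : ∀ (h : Fin k → Fin m) w → mapMaybe isInj₁ w ⊆ tabulate h →
    mapMaybe isInj₂ w ≡ [] → ∃ λ g → (∀ i → g i ≢ 1F) × wordAfter h g ≡ w
  wordAfter-surjective {zero} h [] _ _ = (λ ()) , (λ ()) , refl
  wordAfter-surjective {zero} h (inj₁ _ ∷ _) ()
  wordAfter-surjective {suc k} h [] _ _
    with g , no1 , e ← wordAfter-surjective (h ∘ suc) [] (minimum _) refl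
    = 2F Vector.∷ g , (λ { zero () ; (suc i) → no1 i }) , e
  -- The sublist derivation dictates the entries: a skipped letter means 2, a kept one 0.
  wordAfter-surjective {suc k} h (inj₁ a ∷ w) (_ ∷ʳ s) q
    with g , no1 , e ← wordAfter-surjective (h ∘ suc) (inj₁ a ∷ w) s q
    = 2F Vector.∷ g , (λ { zero () ; (suc i) → no1 i }) , e
  wordAfter-surjective {suc k} h (inj₁ a ∷ w) (refl ∷ s) q
    with g , no1 , e ← wordAfter-surjective (h ∘ suc) w s q
    = 0F Vector.∷ g , (λ { zero () ; (suc i) → no1 i }) , cong (_ ∷_) e

  -- Letters kept in front of b get entry 1. Once b is reached, the rest is read without entries 1,
  -- and `wordBefore-noOne` puts b back at the head.
  wordBefore-surjective : ∀ (h : Fin k → Fin m) w → mapMaybe isInj₁ w ⊆ tabulate h →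
    mapMaybe isInj₂ w ≡ 0F ∷ [] → ∃ λ g → NoOneAfterZero g × wordBefore h g ≡ w
  wordBefore-surjective h (inj₂ 0F ∷ w) s q
    with g , no1 , e ← wordAfter-surjective h w s (∷-injectiveʳ q)
    = g , (λ _ j _ _ → no1 j) , trans (wordBefore-noOne h g no1) (cong (_ ∷_) e)
  wordBefore-surjective {suc k} h (inj₁ a ∷ w) (_ ∷ʳ s) q
    with g , t , e ← wordBefore-surjective (h ∘ suc) (inj₁ a ∷ w) s q
    = 2F Vector.∷ g , noOneAfterZero-cons 2F (λ ()) t , e
  wordBefore-surjective {suc k} h (inj₁ a ∷ w) (refl ∷ s) q
    with g , t , e ← wordBefore-surjective (h ∘ suc) w s q
    = 1F Vector.∷ g , noOneAfterZero-cons 1F (λ ()) t , cong (_ ∷_) e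

-- The encoding of triwords as words and its inverse.

module _ {m : ℕ} where

  -- T2 excludes 2 as first entry.
  toWord : Fin 3 → Vector (Fin 3) m → Word m 1
  toWord 0F = wordAfter id
  toWord _  = wordBefore id

  toWord-A : ∀ c g → mapMaybe isInj₁ (toWord c g) ⊆ tabulate id
  toWord-A 0F      = wordAfter-A id
  toWord-A (suc _) = wordBefore-A id

  toWord-B : ∀ c g → mapMaybe isInj₂ (toWord c g) ⊆ 0F ∷ []
  toWord-B 0F      g = subst (_⊆ _) (sym (wordAfter-B id g)) (0F ∷ʳ [])
  toWord-B (suc _) g = subst (_⊆ _) (sym (wordBefore-B id g)) (refl ∷ [])

  encode : Tri (suc m) → Shuf m 1
  encode u = record
    { word      = toWord (entry u 0F) (entry u ∘ suc)
    ; A-subword = toWord-A (entry u 0F) (entry u ∘ suc)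
    ; B-subword = toWord-B (entry u 0F) (entry u ∘ suc)
    }

  encode-cong : ∀ u v → u ≈ᵀ v → encode u ≈ˢ encode v
  encode-cong u v u≈v with entry u 0F | entry v 0F | u≈v 0F
  ... | 0F    | _ | refl = wordAfter-cong id (u≈v ∘ suc)
  ... | suc _ | _ | refl = wordBefore-cong id (u≈v ∘ suc)

  -- By T3 a triword that starts with 0 has only entries 0 and 2.
  startsZero⇒≡0 : ∀ (u v : Tri (suc m)) → entry u 0F ≡ 0F →
    (∀ i → entry u i ≡ 2F → entry v i ≡ 2F) → ∀ i → entry v i ≢ 2F → entry u i ≡ 0F
  startsZero⇒≡0 u v u0≡0 twos i vi≢2 = decidable-stable (entry u i ≟ 0F) λ ui≢0 →
    vi≢2 (twos i (≢0∧≢1⇒≡2 ui≢0 λ ui≡1 → one⇒nonzero-before u ui≡1 0F z≤n u0≡0))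

  ⊴⇒≼ : ∀ u v → u ⊴ v → encode u ≼ encode v
  ⊴⇒≼ u v (twos , agree) with entry u 0F in u0 | entry v 0F in v0
  ... | 2F | _  = contradiction u0 (T2 u 0F refl)
  ... | _  | 2F = contradiction v0 (T2 v 0F refl)
  ... | 0F | 0F = after⟶*after id _ _ λ i vi≡0 → startsZero⇒≡0 u v u0 twos (suc i)
                    λ vi≡2 → contradiction (trans (sym vi≡0) vi≡2) λ ()
  ... | 0F | 1F = after⟶*before id _ _ (startsZero⇒≡0 u v u0 twos ∘ suc)
  ... | 1F | 1F = before⟶*before id _ _ (noOneAfterZero-tail (T3 u)) (agree refl ∘ suc)
  -- Impossible: agreement at the first position would make the first entry of `v` 1 or 2.
  ... | 1F | 0F with agree refl 0F
  ...   | inj₁ v0≡2  = contradiction (trans (sym v0) v0≡2) λ ()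
  ...   | inj₂ v0≡u0 = contradiction (trans (sym v0) (trans v0≡u0 u0)) λ ()

  inFront-encode⁺ : ∀ v i → entry v (suc i) ≡ 1F → InFront i (word (encode v))
  inFront-encode⁺ v i vi≡1 with entry v 0F in v0
  ... | 0F    = contradiction v0 (one⇒nonzero-before v vi≡1 0F z≤n)
  ... | suc _ = inFront-wordBefore⁺ id _ (noOneAfterZero-tail (T3 v)) i vi≡1

  behind-encode⁺ : ∀ v i → entry v (suc i) ≡ 0F → Behind i (word (encode v))
  behind-encode⁺ v i vi≡0 with entry v 0F
  ... | 0F    = behind-wordAfter⁺ id _ i vi≡0
  ... | suc _ = behind-wordBefore⁺ id _ i vi≡0

  -- Two situations share this form: without b every letter counts as in front and has entry 0, with
  -- b such a letter has entry 1. In both, this is the first entry of `u`.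
  inFront-encode⁻ : ∀ u i → InFront i (word (encode u)) → entry u (suc i) ≡ entry u 0F
  inFront-encode⁻ u i p with entry u 0F in u0
  ... | 0F with _ , refl , ui≡0 ← ∈-wordAfter⁻ id _ (inFront⇒∈ p) = ui≡0
  ... | 1F with _ , refl , ui≡1 ← inFront-wordBefore⁻ id _ p = ui≡1
  ... | 2F = contradiction u0 (T2 u 0F refl)

  behind-encode⁻ : ∀ u i → Behind i (word (encode u)) → entry u (suc i) ≡ 0F
  behind-encode⁻ u i p with entry u 0F
  ... | 0F    with _ , refl , ui≡0 ← ∈-wordAfter⁻ id _ (behind⇒∈ p) = ui≡0
  ... | suc _ with _ , refl , ui≡0 ← behind-wordBefore⁻ id _ p = ui≡0

  noB-encode⁺ : ∀ v → entry v 0F ≡ 0F → NoB (word (encode v))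
  noB-encode⁺ v v0 rewrite v0 = noB-wordAfter id _

  noB-encode⁻ : ∀ u → entry u 0F ≡ 1F → ¬ NoB (word (encode u))
  noB-encode⁻ u u0 rewrite u0 = ¬noB-wordBefore id _

  ≼⇒⊴ : ∀ u v → encode u ≼ encode v → u ⊴ v
  ≼⇒⊴ u v s = twos , agree
    where
    zeros : ∀ i → entry v (suc i) ≡ 0F → entry u (suc i) ≡ 0F
    zeros i = behind-encode⁻ u i ∘ antitone* behind-⟵ s ∘ behind-encode⁺ v i
    ones⇒first : ∀ i → entry v (suc i) ≡ 1F → entry u (suc i) ≡ entry u 0F
    ones⇒first i = inFront-encode⁻ u i ∘ antitone* inFront-⟵ s ∘ inFront-encode⁺ v i

    twos : ∀ i → entry u i ≡ 2F → entry v i ≡ 2F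
    twos zero    u0≡2 = contradiction u0≡2 (T2 u 0F refl)
    twos (suc i) ui≡2 = ≢0∧≢1⇒≡2
      (λ vi≡0 → contradiction (trans (sym ui≡2) (zeros i vi≡0)) λ ())
      -- A 1 of `v` here would equate this entry of `u` with the first one, which is never 2.
      (λ vi≡1 → T2 u 0F refl (trans (sym (ones⇒first i vi≡1)) ui≡2))

    agree : entry u 0F ≡ 1F → ∀ i → entry v i ≡ 2F ⊎ entry v i ≡ entry u i
    agree u0≡1 zero with entry v 0F ≟ 0F
    ... | yes v0≡0 = contradiction (antitone* noB-⟵ s (noB-encode⁺ v v0≡0)) (noB-encode⁻ u u0≡1)
    ... | no v0≢0  = inj₂ (trans (decidable-stable (entry v 0F ≟ 1F)
                       (T2 v 0F refl ∘ ≢0∧≢1⇒≡2 v0≢0)) (sym u0≡1))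
    agree u0≡1 (suc i) with entry v (suc i) in vi
    ... | 0F = inj₂ (sym (zeros i vi))
    ... | 1F = inj₂ (sym (trans (ones⇒first i vi) u0≡1))
    ... | 2F = inj₁ refl

  -- The first entry records whether b occurs. Without b it is 0, and T3 then needs the remaining
  -- entries to avoid 1, as `wordAfter-surjective` guarantees.
  decode : ∀ (w : Shuf m 1) → ∃ λ u → word (encode u) ≡ word w
  decode w with mapMaybe isInj₂ (word w) in bs | B-subword w
  ... | [] | _
    with g , no1 , e ← wordAfter-surjective id (word w) (A-subword w) bs
    = record
      { entry = 0F Vector.∷ g
      ; T2    = λ { zero _ () }
      ; T3    = noOneAfterZero-cons 0F (λ _ → no1) (λ _ j _ _ → no1 j)
      } , e
  ... | _ | refl ∷ []
    with g , t , e ← wordBefore-surjective id (word w) (A-subword w) bs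
    = record
      { entry = 1F Vector.∷ g
      ; T2    = λ { zero _ () }
      ; T3    = noOneAfterZero-cons 1F (λ ()) t
      } , e

theorem1p3 : ∀ (n : ℕ) → n > 0 →
    ∃ λ (f : Lattice.Carrier (Hoch n) → Shuf (n ∸ 1) 1) →
    IsOrderIsomorphism (Lattice._≈_ (Hoch n)) _≈ˢ_ (CoreLabelOrder._⊑_ (Hoch n)) _≼_ f
theorem1p3 (suc m) _ = encode , record
  { isOrderMonomorphism = record
    { isOrderHomomorphism = record
      { cong = λ {u} {v} → encode-cong u v
      ; mono = λ {u} {v} u⊑v → ⊴⇒≼ u v (⊑⇒⊴ u v λ {l} → u⊑v {l})
      }
    ; injective = λ {u} {v} e →
        ⊴-antisym u v (≼⇒⊴ u v (≡⇒≼ e)) (≼⇒⊴ v u (≡⇒≼ (sym e)))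
    ; cancel = λ {u} {v} s {l} → ⊴⇒⊑ u v (≼⇒⊴ u v s) {l}
    }
  ; surjective = λ w → let u , e = decode w in
      u , λ {v} v≈u → trans (encode-cong v u v≈u) e
  }
  where
  ≡⇒≼ : ∀ {w w′ : Word m 1} → w ≡ w′ → Star _⟶_ w w′
  ≡⇒≼ refl = ε
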